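{- Let $p\ge 1$, $q\ge 0$ and $n\ge 1$ be integers. Then $$S_{p}^{(q)}(n)=\sum_{j=1}^{p}(-1)^{p+j}\genfrac{\{}{\}}{0pt}{}{p}{j}\binom{n+q+j}{q+j+1}\,j!.$$
   Context: The hyper-sums of powers of integers are defined by $S_p^{(0)}(n)=S_p(n)=1^p+2^p+\cdots+n^p$ and $S_{p}^{(q)}(n)=\sum_{k=1}^{n}S_{p}^{(q-1)}(k)$ for $q\ge 1$. $\genfrac{\{}{\}}{0pt}{}{p}{j}$ denotes the Stirling number of the second kind. -}

module Defs where

open import Data.Fin.Base using (toℕ)
open import Data.Integer.Base using (ℤ)
open import Data.Nat.Base using (ℕ; zero; suc; _+_; _*_; _^_)
import Algebra.Properties.CommutativeMonoid.Sum as Sum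
import Data.Integer.Properties as ℤ
import Data.Nat.Properties as ℕ

-- Sums over 1 ≤ k ≤ n, so index i : Fin n stands for k = i + 1.

sum₁ : (n : ℕ) → (ℕ → ℕ) → ℕ
sum₁ n f = Sum.sum ℕ.+-0-commutativeMonoid {n} (λ i → f (suc (toℕ i)))

sumℤ₁ : (n : ℕ) → (ℕ → ℤ) → ℤ
sumℤ₁ n f = Sum.sum ℤ.+-0-commutativeMonoid {n} (λ i → f (suc (toℕ i)))

infix 6 sum₁ sumℤ₁

syntax sum₁  n (λ k → e) = ∑[1≤ k ≤ n ] e
syntax sumℤ₁ n (λ k → e) = ∑ℤ[1≤ k ≤ n ] e

-- hyperSum q p n is S_p^{(q)}(n).

hyperSum : (q p n : ℕ) → ℕ
hyperSum zero    p n = ∑[1≤ k ≤ n ] (k ^ p)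
hyperSum (suc q) p n = ∑[1≤ k ≤ n ] hyperSum q p k

-- Stirling numbers of the second kind: stirling₂ p j counts the partitions of
-- a p-element set into j nonempty blocks.  In the last clause a distinguished
-- element either joins one of the suc j blocks of a partition of the remaining
-- p elements, or forms a block on its own.

stirling₂ : (p j : ℕ) → ℕ
stirling₂ zero    zero    = 1
stirling₂ zero    (suc j) = 0
stirling₂ (suc p) zero    = 0
stirling₂ (suc p) (suc j) = suc j * stirling₂ p (suc j) + stirling₂ p j

{-# OPTIONS --safe #-}

-- Write c for a family of binomials and E p c = Σ_{j=1}^{p} (-1)^{p+j} S(p,j) c_j j!,
-- which is additive in c.  The identity k^p = E p (j ↦ C(k-1+j, j)) comes from the
-- recurrence of S(p,j) and the rule x R_j = R_{j+1} - j R_j for the rising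
-- factorials R_j = x (x+1) ⋯ (x+j-1), by telescoping.  Each of the q + 1 summations
-- then raises both the upper and the lower index of the binomials by one (Pascal).

module Submission where

open import Defs
open import Data.Nat.Base using (ℕ; _+_; _≤_; _!)
open import Data.Nat.Combinatorics using (_C_)
open import Data.Integer.Base using (+_; -1ℤ) renaming (_*_ to _*ℤ_; _^_ to _^ℤ_)
open import Relation.Binary.PropositionalEquality using (_≡_)

open import Data.Fin.Base using (toℕ)
open import Data.Integer.Base using (ℤ; 0ℤ; -_) renaming (_+_ to _+ℤ_; _-_ to _-ℤ_)
open import Data.Integer.Tactic.RingSolver using (solve-∀)
open import Data.Nat.Base using (zero; suc; _*_; _^_; _<_; s≤s; z≤n)
open import Data.Nat.Combinatorics using (nC1≡n; nCk+nC[k+1]≡[n+1]C[k+1]; k>n⇒nCk≡0)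
open import Relation.Binary.PropositionalEquality
  using (_≗_; refl; sym; trans; cong; cong₂; module ≡-Reasoning)
import Algebra.Properties.CommutativeMonoid.Sum as Sum
import Algebra.Properties.Semiring.Sum as SemiringSum
import Data.Integer.Properties as ℤ
import Data.Nat.Properties as ℕ
import Data.Nat.Tactic.RingSolver as ℕSolver

open ≡-Reasoning

private
  module Σℕ = Sum ℕ.+-0-commutativeMonoid
  module Σℤ = Sum ℤ.+-0-commutativeMonoid
  module Σℤ* = SemiringSum ℤ.+-*-semiring

-- Absorption, kept free of division. Pascal splits the left binomial, the induction hypotheses for
-- k and k + 1 rewrite both parts, and Pascal recombines them.
[1+k]*[1+n]C[1+k]≡[1+n]*nCk : ∀ n k → suc k * (suc n C suc k) ≡ suc n * (n C k)
[1+k]*[1+n]C[1+k]≡[1+n]*nCk n zero = begin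
  1 * (suc n C 1)   ≡⟨ ℕ.*-identityˡ _ ⟩
  suc n C 1         ≡⟨ nC1≡n (suc n) ⟩
  suc n             ≡⟨ ℕ.*-identityʳ (suc n) ⟨
  suc n * (n C 0)   ∎
[1+k]*[1+n]C[1+k]≡[1+n]*nCk zero (suc k) = begin
  suc (suc k) * (1 C suc (suc k))  ≡⟨ cong (suc (suc k) *_) (k>n⇒nCk≡0 (s≤s (ℕ.0<1+n {k}))) ⟩
  suc (suc k) * 0                  ≡⟨ ℕ.*-zeroʳ (suc (suc k)) ⟩
  0                                ≡⟨ cong (1 *_) (k>n⇒nCk≡0 (ℕ.0<1+n {k})) ⟨
  1 * (0 C suc k)                  ∎
[1+k]*[1+n]C[1+k]≡[1+n]*nCk (suc n) (suc k) = begin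
  (2 + k) * (suc (suc n) C suc (suc k))
    ≡⟨ cong ((2 + k) *_) (nCk+nC[k+1]≡[n+1]C[k+1] (suc n) (suc k)) ⟨
  (2 + k) * (c + (suc n C suc (suc k)))
    ≡⟨ distribute k c _ ⟩
  c + (suc k * c + (2 + k) * (suc n C suc (suc k)))
    ≡⟨ cong (λ z → c + z) (cong₂ _+_ ([1+k]*[1+n]C[1+k]≡[1+n]*nCk n k)
                              ([1+k]*[1+n]C[1+k]≡[1+n]*nCk n (suc k))) ⟩
  c + (suc n * (n C k) + suc n * (n C suc k))
    ≡⟨ cong (λ z → c + z) (ℕ.*-distribˡ-+ (suc n) (n C k) (n C suc k)) ⟨
  c + suc n * (n C k + n C suc k)
    ≡⟨ cong (λ d → c + suc n * d) (nCk+nC[k+1]≡[n+1]C[k+1] n k) ⟩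
  (2 + n) * c ∎
  where
  c = suc n C suc k

  distribute : ∀ k c d → (2 + k) * (c + d) ≡ c + (suc k * c + (2 + k) * d)
  distribute = ℕSolver.solve-∀

p<j⇒stirling₂≡0 : ∀ {p j} → p < j → stirling₂ p j ≡ 0
p<j⇒stirling₂≡0 {zero}  {suc j} _         = refl
p<j⇒stirling₂≡0 {suc p} {suc j} (s≤s p<j) = begin
  suc j * stirling₂ p (suc j) + stirling₂ p j
    ≡⟨ cong₂ (λ a b → suc j * a + b) (p<j⇒stirling₂≡0 (ℕ.m<n⇒m<1+n p<j)) (p<j⇒stirling₂≡0 p<j) ⟩
  suc j * 0 + 0  ≡⟨ ℕ.+-identityʳ _ ⟩
  suc j * 0      ≡⟨ ℕ.*-zeroʳ (suc j) ⟩
  0              ∎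

sum-telescope : ∀ n (g : ℕ → ℤ) →
  Σℤ.sum {n} (λ i → g (toℕ i) -ℤ g (suc (toℕ i))) ≡ g 0 -ℤ g n
sum-telescope zero    g = sym (ℤ.+-inverseʳ (g 0))
sum-telescope (suc n) g = begin
  (g 0 -ℤ g 1) +ℤ _
    ≡⟨ cong ((g 0 -ℤ g 1) +ℤ_) (sum-telescope n (λ i → g (suc i))) ⟩
  (g 0 -ℤ g 1) +ℤ (g 1 -ℤ g (suc n))
    ≡⟨ cancel (g 0) (g 1) (g (suc n)) ⟩
  g 0 -ℤ g (suc n) ∎
  where
  cancel : ∀ a b c → (a -ℤ b) +ℤ (b -ℤ c) ≡ a -ℤ c
  cancel = solve-∀

-- A sum is determined by its value at 0 and its increments. Since `sum₁` unfolds at its first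
-- summand, the induction shifts `f` and `G`, so both must stay general.
sum₁-unique : ∀ (f : ℕ → ℕ) (G : ℕ → ℤ) → G 0 ≡ 0ℤ →
  (∀ n → G (suc n) ≡ G n +ℤ + f (suc n)) → ∀ n → + (sum₁ n f) ≡ G n
sum₁-unique f G G0≡0 step zero    = sym G0≡0
sum₁-unique f G G0≡0 step (suc n) = begin
  + (f 1 + sum₁ n f₁)                ≡⟨ ℤ.pos-+ (f 1) _ ⟩
  + f 1 +ℤ + (sum₁ n f₁)             ≡⟨ cong (+ f 1 +ℤ_) (sum₁-unique f₁ G₁ (ℤ.+-inverseʳ (G 1)) step₁ n) ⟩
  + f 1 +ℤ (G (suc n) -ℤ G 1)        ≡⟨ cong (λ z → + f 1 +ℤ (G (suc n) -ℤ z)) G1≡f1 ⟩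
  + f 1 +ℤ (G (suc n) -ℤ + f 1)      ≡⟨ cancel (+ f 1) (G (suc n)) ⟩
  G (suc n)                          ∎
  where
  f₁ : ℕ → ℕ
  f₁ k = f (suc k)

  -- Subtracting `G 1` makes the shifted function vanish at 0 again.
  G₁ : ℕ → ℤ
  G₁ k = G (suc k) -ℤ G 1

  G1≡f1 : G 1 ≡ + f 1
  G1≡f1 = trans (step 0) (trans (cong (_+ℤ + f 1) G0≡0) (ℤ.+-identityˡ _))

  move : ∀ a b c → (a +ℤ b) -ℤ c ≡ (a -ℤ c) +ℤ b
  move = solve-∀

  cancel : ∀ a b → a +ℤ (b -ℤ a) ≡ b
  cancel = solve-∀

  step₁ : ∀ k → G₁ (suc k) ≡ G₁ k +ℤ + f₁ (suc k)
  step₁ k = trans (cong (_-ℤ G 1) (step (suc k))) (move (G (suc k)) (+ f₁ (suc k)) (G 1))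

-- Also meaningful outside 1 ≤ j ≤ p: the telescoping uses j = 0 and, at its boundary, j = p + 1.
term : (p : ℕ) (c : ℕ → ℕ) (j : ℕ) → ℤ
term p c j = (-1ℤ ^ℤ (p + j)) *ℤ (+ stirling₂ p j) *ℤ (+ c j) *ℤ (+ (j !))

expansion : (p : ℕ) (c : ℕ → ℕ) → ℤ
expansion p c = ∑ℤ[1≤ j ≤ p ] term p c j

expansion-cong : ∀ p {c d} → c ≗ d → expansion p c ≡ expansion p d
expansion-cong p c≗d = Σℤ.sum-cong-≗ {p} λ i →
  cong (λ e → (-1ℤ ^ℤ (p + suc (toℕ i))) *ℤ (+ stirling₂ p (suc (toℕ i))) *ℤ (+ e) *ℤ (+ (suc (toℕ i) !)))
       (c≗d (suc (toℕ i)))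

expansion-+ : ∀ p c d → expansion p (λ j → c j + d j) ≡ expansion p c +ℤ expansion p d
expansion-+ p c d = trans
  (Σℤ.sum-cong-≗ {p} λ i → term-+ (suc (toℕ i)))
  (Σℤ.∑-distrib-+ {p} (λ i → term p c (suc (toℕ i))) (λ i → term p d (suc (toℕ i))))
  where
  distribute : ∀ a b c d → a *ℤ (b +ℤ c) *ℤ d ≡ a *ℤ b *ℤ d +ℤ a *ℤ c *ℤ d
  distribute = solve-∀

  term-+ : ∀ j → term p (λ i → c i + d i) j ≡ term p c j +ℤ term p d j
  term-+ j = trans
    (cong (λ e → (-1ℤ ^ℤ (p + j)) *ℤ (+ stirling₂ p j) *ℤ e *ℤ (+ (j !))) (ℤ.pos-+ (c j) (d j)))
    (distribute ((-1ℤ ^ℤ (p + j)) *ℤ (+ stirling₂ p j)) (+ c j) (+ d j) (+ (j !)))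

term-stirling₂≡0 : ∀ p c j → stirling₂ p j ≡ 0 → term p c j ≡ 0ℤ
term-stirling₂≡0 p c j S≡0 = trans
  (cong (λ a → (-1ℤ ^ℤ (p + j)) *ℤ (+ a) *ℤ (+ c j) *ℤ (+ (j !))) S≡0)
  (annihilate (-1ℤ ^ℤ (p + j)) (+ c j) (+ (j !)))
  where
  annihilate : ∀ s c f → s *ℤ 0ℤ *ℤ c *ℤ f ≡ 0ℤ
  annihilate = solve-∀

expansion-zero : ∀ p c → (∀ j → c j ≡ 0) → expansion p c ≡ 0ℤ
expansion-zero p c c≡0 = trans (Σℤ.sum-cong-≗ {p} λ i → vanish (suc (toℕ i))) (Σℤ.sum-replicate-zero p)
  where
  annihilate : ∀ s f → s *ℤ 0ℤ *ℤ f ≡ 0ℤ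
  annihilate = solve-∀

  vanish : ∀ j → term p c j ≡ 0ℤ
  vanish j = trans
    (cong (λ a → (-1ℤ ^ℤ (p + j)) *ℤ (+ stirling₂ p j) *ℤ (+ a) *ℤ (+ (j !))) (c≡0 j))
    (annihilate ((-1ℤ ^ℤ (p + j)) *ℤ (+ stirling₂ p j)) (+ (j !)))

-- rising m j * j ! is the rising factorial (m+1)(m+2)⋯(m+j).
rising : (m j : ℕ) → ℕ
rising m j = (m + j) C j

-- Absorption at upper index m + j. Multiplied by j!, it is R_{j+1} = (x + j) R_j with x = m + 1.
[1+j]*rising : ∀ m j → + suc j *ℤ + rising m (suc j) ≡ (+ suc m +ℤ + j) *ℤ + rising m j
[1+j]*rising m j = begin
  + suc j *ℤ + ((m + suc j) C suc j)   ≡⟨ ℤ.pos-* (suc j) _ ⟨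
  + (suc j * ((m + suc j) C suc j))    ≡⟨ cong (λ n → + (suc j * (n C suc j))) (ℕ.+-suc m j) ⟩
  + (suc j * (suc (m + j) C suc j))    ≡⟨ cong +_ ([1+k]*[1+n]C[1+k]≡[1+n]*nCk (m + j) j) ⟩
  + (suc (m + j) * ((m + j) C j))      ≡⟨ ℤ.pos-* (suc (m + j)) _ ⟩
  + (suc m + j) *ℤ + ((m + j) C j)     ≡⟨ cong (_*ℤ + ((m + j) C j)) (ℤ.pos-+ (suc m) j) ⟩
  (+ suc m +ℤ + j) *ℤ + rising m j     ∎

-- In the recurrence of S(p+1, j+1), the summand S(p, j) contributes (x + j) t_j and the summand
-- (j+1) S(p, j+1) contributes -(j+1) t_{j+1}, the sign having flipped. Beyond x t_j there remains a
-- difference of consecutive values of j t_j.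
term-rising-suc : ∀ m p j → let t = term p (rising m) in
  term (suc p) (rising m) (suc j) ≡ + suc m *ℤ t j +ℤ (+ j *ℤ t j -ℤ + suc j *ℤ t (suc j))
term-rising-suc m p j = begin
  (-1ℤ *ℤ (-1ℤ ^ℤ (p + suc j))) *ℤ (+ (suc j * S₁ + S₀)) *ℤ r₁ *ℤ (+ (suc j * j !))
    ≡⟨ cong₂ (λ a b → (-1ℤ *ℤ u) *ℤ a *ℤ r₁ *ℤ b)
             (trans (ℤ.pos-+ (suc j * S₁) S₀) (cong (_+ℤ + S₀) (ℤ.pos-* (suc j) S₁)))
             (ℤ.pos-* (suc j) (j !)) ⟩
  (-1ℤ *ℤ u) *ℤ (y *ℤ (+ S₁) +ℤ + S₀) *ℤ r₁ *ℤ (y *ℤ f)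
    -- The factor `y` of (j+1)! moves to `r₁` in the `S₀` part, ready for absorption, and stays with
    -- j! in the `S₁` part, where it rebuilds the factorial of t_{j+1}.
    ≡⟨ isolate u y (+ S₁) (+ S₀) r₁ f ⟩
  (- u) *ℤ (+ S₀) *ℤ f *ℤ (y *ℤ r₁) -ℤ y *ℤ (u *ℤ (+ S₁) *ℤ r₁ *ℤ (y *ℤ f))
    ≡⟨ cong₂ (λ a b → a *ℤ (+ S₀) *ℤ f *ℤ b -ℤ y *ℤ (u *ℤ (+ S₁) *ℤ r₁ *ℤ (y *ℤ f)))
             -u≡s ([1+j]*rising m j) ⟩
  s *ℤ (+ S₀) *ℤ f *ℤ ((x +ℤ + j) *ℤ r₀) -ℤ y *ℤ (u *ℤ (+ S₁) *ℤ r₁ *ℤ (y *ℤ f))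
    ≡⟨ cong (λ b → s *ℤ (+ S₀) *ℤ f *ℤ ((x +ℤ + j) *ℤ r₀) -ℤ y *ℤ (u *ℤ (+ S₁) *ℤ r₁ *ℤ b))
            (ℤ.pos-* (suc j) (j !)) ⟨
  s *ℤ (+ S₀) *ℤ f *ℤ ((x +ℤ + j) *ℤ r₀) -ℤ y *ℤ term p (rising m) (suc j)
    ≡⟨ split s (+ S₀) f x (+ j) r₀ (y *ℤ term p (rising m) (suc j)) ⟩
  x *ℤ term p (rising m) j +ℤ (+ j *ℤ term p (rising m) j -ℤ y *ℤ term p (rising m) (suc j)) ∎
  where
  s = -1ℤ ^ℤ (p + j)
  u = -1ℤ ^ℤ (p + suc j)
  S₀ = stirling₂ p j
  S₁ = stirling₂ p (suc j)
  r₀ = + rising m j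
  r₁ = + rising m (suc j)
  f = + (j !)
  x = + suc m
  y = + suc j

  -u≡s : - u ≡ s
  -u≡s = begin
    - u           ≡⟨ cong (λ n → - (-1ℤ ^ℤ n)) (ℕ.+-suc p j) ⟩
    - (-1ℤ *ℤ s)  ≡⟨ cong -_ (ℤ.-1*i≡-i s) ⟩
    - - s         ≡⟨ ℤ.neg-involutive s ⟩
    s             ∎

  isolate : ∀ u y S₁ S₀ r f →
    (-1ℤ *ℤ u) *ℤ (y *ℤ S₁ +ℤ S₀) *ℤ r *ℤ (y *ℤ f) ≡
    (- u) *ℤ S₀ *ℤ f *ℤ (y *ℤ r) -ℤ y *ℤ (u *ℤ S₁ *ℤ r *ℤ (y *ℤ f))
  isolate = solve-∀

  split : ∀ s S f x j r z →
    s *ℤ S *ℤ f *ℤ ((x +ℤ j) *ℤ r) -ℤ z ≡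
    x *ℤ (s *ℤ S *ℤ r *ℤ f) +ℤ (j *ℤ (s *ℤ S *ℤ r *ℤ f) -ℤ z)
  split = solve-∀

-- Starting at j = 0 lets the induction begin at p = 0, where S(0, 0) = 1 gives the only term. Each
-- step multiplies by x = m + 1, the rest telescoping away.
sum-term-rising : ∀ m p → Σℤ.sum {suc p} (λ i → term p (rising m) (toℕ i)) ≡ + (suc m ^ p)
sum-term-rising m zero    = refl
sum-term-rising m (suc p) = begin
  term (suc p) (rising m) 0 +ℤ Σℤ.sum {suc p} (λ i → term (suc p) (rising m) (suc (toℕ i)))
    ≡⟨ cong₂ _+ℤ_ (term-stirling₂≡0 (suc p) (rising m) 0 refl)
                  (Σℤ.sum-cong-≗ {suc p} λ i → term-rising-suc m p (toℕ i)) ⟩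
  0ℤ +ℤ Σℤ.sum {suc p} (λ i → x *ℤ t (toℕ i) +ℤ (g (toℕ i) -ℤ g (suc (toℕ i))))
    ≡⟨ ℤ.+-identityˡ _ ⟩
  Σℤ.sum {suc p} (λ i → x *ℤ t (toℕ i) +ℤ (g (toℕ i) -ℤ g (suc (toℕ i))))
    ≡⟨ Σℤ.∑-distrib-+ {suc p} (λ i → x *ℤ t (toℕ i)) (λ i → g (toℕ i) -ℤ g (suc (toℕ i))) ⟩
  Σℤ.sum {suc p} (λ i → x *ℤ t (toℕ i)) +ℤ Σℤ.sum {suc p} (λ i → g (toℕ i) -ℤ g (suc (toℕ i)))
    ≡⟨ cong₂ _+ℤ_ (sym (Σℤ*.*-distribˡ-sum {suc p} x (λ i → t (toℕ i)))) (sum-telescope (suc p) g) ⟩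
  x *ℤ Σℤ.sum {suc p} (λ i → t (toℕ i)) +ℤ (g 0 -ℤ g (suc p))
    ≡⟨ cong₂ _+ℤ_ (cong (x *ℤ_) (sum-term-rising m p)) boundary ⟩
  x *ℤ + (suc m ^ p) +ℤ 0ℤ
    ≡⟨ ℤ.+-identityʳ _ ⟩
  x *ℤ + (suc m ^ p)
    ≡⟨ ℤ.pos-* (suc m) (suc m ^ p) ⟨
  + (suc m ^ suc p) ∎
  where
  x = + suc m
  t = term p (rising m)

  g : ℕ → ℤ
  g i = + i *ℤ t i

  -- The lower end vanishes through the factor j = 0, the upper end through S(p, p+1) = 0.
  boundary : g 0 -ℤ g (suc p) ≡ 0ℤ
  boundary = cong₂ _-ℤ_ (ℤ.*-zeroˡ (t 0)) (trans
    (cong (+ suc p *ℤ_) (term-stirling₂≡0 p (rising m) (suc p) (p<j⇒stirling₂≡0 (ℕ.n<1+n p))))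
    (ℤ.*-zeroʳ (+ suc p)))

-- Dropping j = 0 is harmless because S(p, 0) = 0 for p ≥ 1; for p = 0 that term is 1 and the
-- remaining sum is empty.
expansion-rising : ∀ p m → 1 ≤ p → expansion p (rising m) ≡ + (suc m ^ p)
expansion-rising p@(suc _) m _ = begin
  expansion p (rising m)                            ≡⟨ ℤ.+-identityˡ _ ⟨
  0ℤ +ℤ expansion p (rising m)                      ≡⟨ cong (_+ℤ expansion p (rising m)) (term-stirling₂≡0 p (rising m) 0 refl) ⟨
  term p (rising m) 0 +ℤ expansion p (rising m)     ≡⟨ sum-term-rising m p ⟩
  + (suc m ^ p)                                     ∎

hyperBinomial : (q n j : ℕ) → ℕ
hyperBinomial q n j = (n + q + j) C (q + j + 1)

hyperBinomial-0 : ∀ q j → hyperBinomial q 0 j ≡ 0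
hyperBinomial-0 q j = k>n⇒nCk≡0 (ℕ.m<m+n (q + j) (s≤s z≤n))

-- The increment is the binomial belonging to the summand at n + 1: `rising n j` if q = 0, and
-- `hyperBinomial (q - 1) (n + 1) j` otherwise.
pascal : ∀ q n j →
  hyperBinomial q (suc n) j ≡ hyperBinomial q n j + ((n + q + j) C (q + j))
pascal q n j = begin
  suc (n + q + j) C (q + j + 1)                       ≡⟨ cong (suc (n + q + j) C_) (ℕ.+-comm (q + j) 1) ⟩
  suc (n + q + j) C suc (q + j)                       ≡⟨ nCk+nC[k+1]≡[n+1]C[k+1] (n + q + j) (q + j) ⟨
  (n + q + j) C (q + j) + (n + q + j) C suc (q + j)   ≡⟨ ℕ.+-comm ((n + q + j) C (q + j)) _ ⟩
  (n + q + j) C suc (q + j) + (n + q + j) C (q + j)   ≡⟨ cong (λ k → (n + q + j) C k + (n + q + j) C (q + j)) (ℕ.+-comm 1 (q + j)) ⟩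
  hyperBinomial q n j + (n + q + j) C (q + j)         ∎

-- A sum of q-fold hyper-sums satisfies the (q+1)-fold formula as soon as the
-- summands have the binomials C(n+q+j, q+j) in their expansion; for q = 0 the
-- summands are the powers themselves.
sum₁-expansion : ∀ p q (f : ℕ → ℕ) →
  (∀ n → + f (suc n) ≡ expansion p (λ j → (n + q + j) C (q + j))) →
  ∀ n → + (sum₁ n f) ≡ expansion p (hyperBinomial q n)
sum₁-expansion p q f f-expansion = sum₁-unique f (λ n → expansion p (hyperBinomial q n))
  (expansion-zero p (hyperBinomial q 0) (hyperBinomial-0 q))
  λ n → begin
    expansion p (hyperBinomial q (suc n))
      ≡⟨ expansion-cong p (pascal q n) ⟩
    expansion p (λ j → hyperBinomial q n j + ((n + q + j) C (q + j)))
      ≡⟨ expansion-+ p (hyperBinomial q n) (λ j → (n + q + j) C (q + j)) ⟩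
    expansion p (hyperBinomial q n) +ℤ expansion p (λ j → (n + q + j) C (q + j))
      ≡⟨ cong (expansion p (hyperBinomial q n) +ℤ_) (f-expansion n) ⟨
    expansion p (hyperBinomial q n) +ℤ + f (suc n) ∎

hyperSum-expansion : ∀ p q → 1 ≤ p → ∀ n → + (hyperSum q p n) ≡ expansion p (hyperBinomial q n)
hyperSum-expansion p zero    1≤p = sum₁-expansion p 0 (_^ p) λ n → begin
  + (suc n ^ p)                              ≡⟨ expansion-rising p n 1≤p ⟨
  expansion p (rising n)                     ≡⟨ expansion-cong p (λ j → cong (λ k → (k + j) C j) (sym (ℕ.+-identityʳ n))) ⟩
  expansion p (λ j → (n + 0 + j) C j)        ∎
hyperSum-expansion p (suc q) 1≤p = sum₁-expansion p (suc q) (hyperSum q p) λ n → begin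
  + hyperSum q p (suc n)                     ≡⟨ hyperSum-expansion p q 1≤p (suc n) ⟩
  expansion p (hyperBinomial q (suc n))
    -- Since (n + 1) + q = n + (q + 1), the shift of the argument becomes the shift of the order q.
    ≡⟨ expansion-cong p (λ j → cong₂ _C_ (cong (_+ j) (sym (ℕ.+-suc n q))) (ℕ.+-comm (q + j) 1)) ⟩
  expansion p (λ j → (n + suc q + j) C (suc q + j)) ∎

theorem9 : (p q n : ℕ) → 1 ≤ p → 1 ≤ n →
    + (hyperSum q p n) ≡ ∑ℤ[1≤ j ≤ p ] ((-1ℤ ^ℤ (p + j)) *ℤ (+ stirling₂ p j) *ℤ (+ ((n + q + j) C (q + j + 1))) *ℤ (+ (j !)))
theorem9 p q n 1≤p _ = hyperSum-expansion p q 1≤p n
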